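{- Consider the Hopf monoids $\mathbf{L}$, $\mathbf{S\Sigma}$, $\overrightarrow{\mathbf{A}}$, $\mathbf{S\Pi}$, $\mathbf{E}$ (braiding $x\otimes y\mapsto y\otimes x$) and the maps: $\iota:\mathbf{L}\to\mathbf{S\Sigma}$, $\ell_1<\cdots<\ell_n\mapsto\{\ell_1\}|\cdots|\{\ell_n\}$; $\overrightarrow{\pi}:\mathbf{L}\to\overrightarrow{\mathbf{A}}$, orienting each edge $uv$ as $u\to v$ when $u<_\ell v$; $\overrightarrow{\pi}:\mathbf{S\Sigma}\to\overrightarrow{\mathbf{A}}$, orienting each edge $uv$ with $u\in S_i$, $v\in S_j$, $i<j$ as $u\to v$; $\pi:\mathbf{S\Sigma}\to\mathbf{S\Pi}$, $C\mapsto m_{\pi(C)}$ (the underlying partition); $\rho:\mathbf{S\Pi}\to\mathbf{E}$, $m_\sigma\mapsto1$; $\pi:\overrightarrow{\mathbf{A}}\to\mathbf{E}$, every acyclic orientation $\mapsto1$. Then all these maps are Hopf monoid morphisms, the diagram commutes ($\overrightarrow{\pi}\circ\iota=\overrightarrow{\pi}$ on $\mathbf{L}$ and $\pi\circ\overrightarrow{\pi}=\rho\circ\pi$ on $\mathbf{S\Sigma}$), and the resulting map $\mathbf{L}\to\mathbf{E}$ is the abelianization map sending every linear order to $1$.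
   Context: All graphs are finite simple graphs over a field $\mathbb{K}$; $G_S$ is the induced subgraph. Hopf monoids are in graphical species (functors from finite graphs with isomorphisms to $\mathbb{K}$-vector spaces) with respect to the Cauchy product $(\mathbf{g}\cdot\mathbf{h})[G]=\bigoplus_{S|T\models V(G)}\mathbf{g}[G_S]\otimes\mathbf{h}[G_T]$ (ordered pairs of disjoint possibly empty sets with union $V(G)$) and symmetry $x\otimes y\mapsto y\otimes x$. $\mathbf{L}$: basis linear orders on $V(G)$, product concatenation, coproduct $\ell\mapsto\ell|_S\otimes\ell|_T$. $\mathbf{S\Sigma}$: basis stable compositions $C_1|\cdots|C_k$ of $V(G)$ (each $G_{C_i}$ edgeless), product concatenation, coproduct $C\mapsto C_S\otimes C_T$ ($C_S$ = $C_1\cap S|\cdots|C_k\cap S$ with empty blocks removed). $\overrightarrow{\mathbf{A}}$: basis acyclic orientations of $G$, product: union plus every edge $st$ ($s\in S,t\in T$) directed $s\to t$, coproduct: restriction to $G_S$ and $G_T$. $\mathbf{S\Pi}$: basis $m_\pi$ for stable partitions $\pi$ of $V(G)$ (no edge inside a block), product $m_\sigma\otimes m_\tau\mapsto m_{\sigma\cup\tau}$, coproduct $m_\pi\mapsto m_{\pi|_S}\otimes m_{\pi|_T}$. $\mathbf{E}[G]=\mathbb{K}$ with product and coproduct the canonical isomorphisms $\mathbb{K}\otimes\mathbb{K}\cong\mathbb{K}$. -}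

module Defs where

open import Level using (0ℓ)
open import Data.Nat using (ℕ)
open import Data.Bool using (Bool; true; false; _∧_; _∨_)
open import Data.Unit using (⊤; tt)
open import Data.Product using (_×_; _,_; Σ; ∃)
open import Data.Sum using (_⊎_)
open import Data.Fin using (Fin)
open import Data.Fin.Properties as FinP using ()
open import Data.Fin.Subset using (Subset; _∈_; _∩_; _∪_; ⊥; ⁅_⁆; Nonempty)
open import Data.Fin.Subset.Properties using (_∈?_)
open import Data.Fin.Permutation using (Permutation′; _⟨$⟩ʳ_; _⟨$⟩ˡ_)
open import Data.List using (List; []; _∷_; _++_; map; filter; foldr)
open import Data.Bool.ListAction using (any)
open import Data.List.Membership.Propositional renaming (_∈_ to _∈ₗ_)
open import Data.List.Relation.Unary.All using (All)
open import Data.List.Relation.Unary.AllPairs using (AllPairs)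
open import Data.List.Relation.Unary.Unique.Propositional using (Unique)
open import Data.Vec using (tabulate; lookup)
open import Data.Vec.Properties using (≡-dec)
open import Relation.Nullary using (¬_; does; ¬?)
open import Relation.Binary.PropositionalEquality using (_≡_)
open import Relation.Binary.Construct.Closure.Transitive using (TransClosure)
open import Function.Bundles using (_⇔_)

-- Finite simple graphs on the vertex set Fin n.
-- A component G_U of a graphical species is represented by an ambient
-- graph G together with a vertex subset U : Subset n (induced subgraph).

record Graph (n : ℕ) : Set where
  field
    adj : Fin n → Fin n → Bool
    adj-sym : ∀ u v → adj u v ≡ adj v u
    adj-irr : ∀ u → adj u u ≡ false
open Graph public

Edge : ∀ {n} → Graph n → Fin n → Fin n → Set
Edge G u v = adj G u v ≡ true

_∈ᵇ_ : ∀ {n} → Fin n → Subset n → Bool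
v ∈ᵇ S = does (v ∈? S)

_≟S_ : ∀ {n} (S T : Subset n) → Relation.Nullary.Dec (S ≡ T)
_≟S_ = ≡-dec Data.Bool._≟_

Decomp : ∀ {n} → Subset n → Subset n → Subset n → Set
Decomp U S T = (S ∩ T ≡ ⊥) × (S ∪ T ≡ U)

IsGraphIso : ∀ {n} → Permutation′ n → Graph n → Graph n → Set
IsGraphIso σ G G' = ∀ u v → adj G' (σ ⟨$⟩ʳ u) (σ ⟨$⟩ʳ v) ≡ adj G u v

imageS : ∀ {n} → Permutation′ n → Subset n → Subset n
imageS σ U = tabulate (λ v → lookup U (σ ⟨$⟩ˡ v))

-- Linearized set-theoretic graphical species with a Hopf structure on bases.
-- Raw n      : raw data for structures (basis elements) on subsets of Fin n
-- Valid G U x: x is a basis element of the component at G_U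
-- _≈_        : equality of basis elements
-- mul G S T  : product  h[G_S] ⊗ h[G_T] → h[G_{S∪T}] on basis elements
-- res S      : the S-component of the coproduct (Δ_{S,T}(x) = res S x ⊗ res T x)
-- unit       : the basis element on the empty graph
-- relabel σ  : transport of structure along a graph isomorphism σ

record BasisHopfSpecies : Set₁ where
  field
    Raw : ℕ → Set
    Valid : ∀ {n} → Graph n → Subset n → Raw n → Set
    _≈_ : ∀ {n} → Raw n → Raw n → Set
    mul : ∀ {n} → Graph n → Subset n → Subset n → Raw n → Raw n → Raw n
    res : ∀ {n} → Subset n → Raw n → Raw n
    unit : ∀ {n} → Raw n
    relabel : ∀ {n} → Permutation′ n → Raw n → Raw n
open BasisHopfSpecies public

-- A morphism of Hopf monoids which is the linear extension of a map
-- sending basis elements to basis elements.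
record IsHopfMorphism (h k : BasisHopfSpecies)
       (f : ∀ {n} → Graph n → Raw h n → Raw k n) : Set where
  field
    well-defined : ∀ {n} (G : Graph n) (U : Subset n) (x : Raw h n) →
      Valid h G U x → Valid k G U (f G x)
    natural : ∀ {n} (σ : Permutation′ n) (G G' : Graph n) → IsGraphIso σ G G' →
      ∀ (U : Subset n) (x : Raw h n) → Valid h G U x →
      _≈_ k (f G' (relabel h σ x)) (relabel k σ (f G x))
    pres-mul : ∀ {n} (G : Graph n) (U S T : Subset n) → Decomp U S T →
      ∀ (x y : Raw h n) → Valid h G S x → Valid h G T y →
      _≈_ k (f G (mul h G S T x y)) (mul k G S T (f G x) (f G y))
    pres-comul : ∀ {n} (G : Graph n) (U S T : Subset n) → Decomp U S T →
      ∀ (x : Raw h n) → Valid h G U x →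
      _≈_ k (f G (res h S x)) (res k S (f G x)) ×
      _≈_ k (f G (res h T x)) (res k T (f G x))
    pres-unit : ∀ {n} (G : Graph n) → _≈_ k (f G (unit h)) (unit k)

IsLinOrd : ∀ {n} → Graph n → Subset n → List (Fin n) → Set
IsLinOrd G U ℓ = Unique ℓ × (∀ v → (v ∈ₗ ℓ) ⇔ (v ∈ U))

𝐋 : BasisHopfSpecies
𝐋 = record
  { Raw = λ n → List (Fin n)
  ; Valid = IsLinOrd
  ; _≈_ = _≡_
  ; mul = λ G S T ℓ ℓ' → ℓ ++ ℓ'
  ; res = λ S ℓ → filter (_∈? S) ℓ
  ; unit = []
  ; relabel = λ σ ℓ → map (σ ⟨$⟩ʳ_) ℓ
  }

Stable : ∀ {n} → Graph n → Subset n → Set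
Stable G B = ∀ u v → u ∈ B → v ∈ B → adj G u v ≡ false

IsStableComp : ∀ {n} → Graph n → Subset n → List (Subset n) → Set
IsStableComp G U C =
  All Nonempty C × AllPairs (λ A B → A ∩ B ≡ ⊥) C ×
  (foldr _∪_ ⊥ C ≡ U) × All (Stable G) C

restrictComp : ∀ {n} → Subset n → List (Subset n) → List (Subset n)
restrictComp S C = filter (λ B → ¬? (B ≟S ⊥)) (map (_∩ S) C)

𝐒𝚺 : BasisHopfSpecies
𝐒𝚺 = record
  { Raw = λ n → List (Subset n)
  ; Valid = IsStableComp
  ; _≈_ = _≡_
  ; mul = λ G S T C D → C ++ D
  ; res = restrictComp
  ; unit = []
  ; relabel = λ σ C → map (imageS σ) C
  }

-- A⃗ : acyclic orientations; o u v ≡ true means the edge uv is directed u → v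

IsAcyclicOrientation : ∀ {n} → Graph n → Subset n → (Fin n → Fin n → Bool) → Set
IsAcyclicOrientation G U o =
  (∀ u v → o u v ≡ true → (u ∈ U × v ∈ U × Edge G u v)) ×
  (∀ u v → u ∈ U → v ∈ U → Edge G u v → (o u v ≡ true ⊎ o v u ≡ true)) ×
  (∀ u v → o u v ≡ true → o v u ≡ false) ×
  (∀ u → ¬ TransClosure (λ a b → o a b ≡ true) u u)

𝐀⃗ : BasisHopfSpecies
𝐀⃗ = record
  { Raw = λ n → Fin n → Fin n → Bool
  ; Valid = IsAcyclicOrientation
  ; _≈_ = λ o o' → ∀ u v → o u v ≡ o' u v
  ; mul = λ G S T o o' u v → o u v ∨ o' u v ∨ (u ∈ᵇ S ∧ v ∈ᵇ T ∧ adj G u v)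
  ; res = λ S o u v → o u v ∧ u ∈ᵇ S ∧ v ∈ᵇ S
  ; unit = λ u v → false
  ; relabel = λ σ o u v → o (σ ⟨$⟩ˡ u) (σ ⟨$⟩ˡ v)
  }

-- SΠ : basis m_π, π a stable partition of U, encoded by its
-- "same block" relation (an equivalence relation on U, false off U)

IsStablePartition : ∀ {n} → Graph n → Subset n → (Fin n → Fin n → Bool) → Set
IsStablePartition G U p =
  (∀ u v → p u v ≡ true → (u ∈ U × v ∈ U)) ×
  (∀ u → u ∈ U → p u u ≡ true) ×
  (∀ u v → p u v ≡ true → p v u ≡ true) ×
  (∀ u v w → p u v ≡ true → p v w ≡ true → p u w ≡ true) ×
  (∀ u v → p u v ≡ true → adj G u v ≡ false)

𝐒𝚷 : BasisHopfSpecies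
𝐒𝚷 = record
  { Raw = λ n → Fin n → Fin n → Bool
  ; Valid = IsStablePartition
  ; _≈_ = λ p p' → ∀ u v → p u v ≡ p' u v
  ; mul = λ G S T p p' u v → p u v ∨ p' u v
  ; res = λ S p u v → p u v ∧ u ∈ᵇ S ∧ v ∈ᵇ S
  ; unit = λ u v → false
  ; relabel = λ σ p u v → p (σ ⟨$⟩ˡ u) (σ ⟨$⟩ˡ v)
  }

𝐄 : BasisHopfSpecies
𝐄 = record
  { Raw = λ n → ⊤
  ; Valid = λ G U x → ⊤
  ; _≈_ = _≡_
  ; mul = λ G S T x y → tt
  ; res = λ S x → tt
  ; unit = tt
  ; relabel = λ σ x → x
  }

before : ∀ {n} → List (Fin n) → Fin n → Fin n → Bool
before [] u v = false
before (x ∷ xs) u v =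
  (does (x FinP.≟ u) ∧ any (λ y → does (y FinP.≟ v)) xs) ∨ before xs u v

blockBefore : ∀ {n} → List (Subset n) → Fin n → Fin n → Bool
blockBefore [] u v = false
blockBefore (B ∷ Bs) u v = (u ∈ᵇ B ∧ v ∈ᵇ foldr _∪_ ⊥ Bs) ∨ blockBefore Bs u v

sameBlock : ∀ {n} → List (Subset n) → Fin n → Fin n → Bool
sameBlock C u v = any (λ B → u ∈ᵇ B ∧ v ∈ᵇ B) C

ι : ∀ {n} → Graph n → List (Fin n) → List (Subset n)
ι G ℓ = map ⁅_⁆ ℓ

π⃗ᴸ : ∀ {n} → Graph n → List (Fin n) → (Fin n → Fin n → Bool)
π⃗ᴸ G ℓ u v = adj G u v ∧ before ℓ u v

π⃗ˢ : ∀ {n} → Graph n → List (Subset n) → (Fin n → Fin n → Bool)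
π⃗ˢ G C u v = adj G u v ∧ blockBefore C u v

πˢ : ∀ {n} → Graph n → List (Subset n) → (Fin n → Fin n → Bool)
πˢ G C = sameBlock C

ρ : ∀ {n} → Graph n → (Fin n → Fin n → Bool) → ⊤
ρ G p = tt

πᴬ : ∀ {n} → Graph n → (Fin n → Fin n → Bool) → ⊤
πᴬ G o = tt

-- A composition C carries two Boolean relations on vertices: u lies in an earlier block than v,
-- and u, v lie in a common block.  Concatenation, restriction to S and relabelling of
-- compositions act on them exactly as product, coproduct and relabelling act in 𝐀⃗ and 𝐒𝚷, so
-- π⃗ˢ and πˢ are Hopf morphisms; π⃗ˢ C is acyclic because the index of the block containing a
-- vertex strictly increases along every arrow.  Under ι a linear order becomes the composition
-- into singletons, whose block order is the order itself, so π⃗ᴸ = π⃗ˢ ∘ ι is a morphism as a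
-- composite.  Maps into 𝐄 are morphisms because each component of 𝐄 has one basis element.
module Submission where

open import Defs
open import Data.Bool using (Bool; true; false; _∧_; _∨_; if_then_else_)
open import Data.Bool.Properties using (∧-assoc; ∧-comm; ∧-zeroʳ; ∨-assoc; ∨-identityʳ; ∨-zeroʳ)
open import Data.Bool.Solver using (module ∨-∧-Solver)
open import Data.Bool.ListAction using (any)
open import Data.Fin using (Fin; _≟_)
open import Data.Fin.Permutation using (Permutation′; _⟨$⟩ʳ_; _⟨$⟩ˡ_; inverseʳ; inverseˡ)
open import Data.Fin.Subset using (Subset; _∈_; _∉_; _⊆_; _∩_; _∪_; ⊥; ⁅_⁆; ⋃)
open import Data.Fin.Subset.Properties
  using ( _∈?_; ∉⊥; x∈⁅x⁆; x∈⁅y⁆⇒x≡y; ∪⇔⊎; ∩⇔×; x∈p∪q⁻; x∈p∩q⁻; x∈p∩q⁺; p⊆p∪q; q⊆p∪q; p∩q⊆p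
        ; ⊆-antisym; Empty-unique)
open import Data.List using (List; []; _∷_; _++_; map; filter)
open import Data.List.Relation.Unary.Any using (any?)
open import Data.List.Properties using (filter-accept; filter-reject; map-++; map-∘; map-cong)
open import Data.List.Relation.Unary.All as All using (All; []; _∷_)
open import Data.List.Relation.Unary.All.Properties as All using ()
open import Data.List.Relation.Unary.AllPairs as AllPairs using (AllPairs; []; _∷_)
open import Data.List.Relation.Unary.AllPairs.Properties as AllPairs using ()
open import Data.Nat using (ℕ; zero; suc; _<_; z<s; s<s)
open import Data.Nat.Properties using (<-irrefl; <-asym; <-trans)
open import Data.Product as Product using (_×_; _,_; proj₁; proj₂)
open import Data.Sum as Sum using (_⊎_; inj₁; inj₂)
open import Data.Unit using (tt)
open import Data.Vec.Properties using ([]=⇒lookup; lookup⇒[]=; lookup∘tabulate)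
open import Function using (_∘_; id)
open import Function.Bundles using (_⇔_; mk⇔; Equivalence)
open import Relation.Binary.Construct.Closure.Transitive as Transitive using (TransClosure; [_]; _∷_)
open import Relation.Binary.PropositionalEquality
open import Relation.Nullary using (¬_; yes; no; does; ¬?; contradiction)
open import Relation.Nullary.Decidable using (dec-true; dec-false; does-⇔; _⊎-dec_; _×-dec_)

open ≡-Reasoning
open ∨-∧-Solver using (solve; _:=_; _:+_; _:*_)

private
  variable
    n : ℕ

∧≡true⇒× : ∀ {a b} → a ∧ b ≡ true → a ≡ true × b ≡ true
∧≡true⇒× {true} {true} _ = refl , refl

∨≡true⇒⊎ : ∀ {a b} → a ∨ b ≡ true → a ≡ true ⊎ b ≡ true
∨≡true⇒⊎ {true} _ = inj₁ refl
∨≡true⇒⊎ {false} b≡true = inj₂ b≡true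

∈ᵇ⇒∈ : {v : Fin n} {S : Subset n} → v ∈ᵇ S ≡ true → v ∈ S
∈ᵇ⇒∈ {v = v} {S} e with v ∈? S | e
... | yes v∈S | _ = v∈S

∈⇒∈ᵇ : {v : Fin n} {S : Subset n} → v ∈ S → v ∈ᵇ S ≡ true
∈⇒∈ᵇ {v = v} {S} = dec-true (v ∈? S)

∉⇒∈ᵇ : {v : Fin n} {S : Subset n} → v ∉ S → v ∈ᵇ S ≡ false
∉⇒∈ᵇ {v = v} {S} = dec-false (v ∈? S)

∈ᵇ-∧⁻ : (u v : Fin n) (A B : Subset n) → u ∈ᵇ A ∧ v ∈ᵇ B ≡ true → u ∈ A × v ∈ B
∈ᵇ-∧⁻ u v A B e = Product.map ∈ᵇ⇒∈ ∈ᵇ⇒∈ (∧≡true⇒× e)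

∈ᵇ-ext : {S T : Subset n} → (∀ v → v ∈ᵇ S ≡ v ∈ᵇ T) → S ≡ T
∈ᵇ-ext S≗T = ⊆-antisym
  (λ {v} v∈S → ∈ᵇ⇒∈ (trans (sym (S≗T v)) (∈⇒∈ᵇ v∈S)))
  (λ {v} v∈T → ∈ᵇ⇒∈ (trans (S≗T v) (∈⇒∈ᵇ v∈T)))

∈ᵇ-⊥ : (v : Fin n) → v ∈ᵇ ⊥ ≡ false
∈ᵇ-⊥ v = dec-false (v ∈? ⊥) ∉⊥

∈ᵇ-∪ : (v : Fin n) (A B : Subset n) → v ∈ᵇ (A ∪ B) ≡ v ∈ᵇ A ∨ v ∈ᵇ B
∈ᵇ-∪ v A B = does-⇔ ∪⇔⊎ (v ∈? A ∪ B) (v ∈? A ⊎-dec v ∈? B)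

∈ᵇ-∩ : (v : Fin n) (A B : Subset n) → v ∈ᵇ (A ∩ B) ≡ v ∈ᵇ A ∧ v ∈ᵇ B
∈ᵇ-∩ v A B = does-⇔ ∩⇔× (v ∈? A ∩ B) (v ∈? A ×-dec v ∈? B)

∈ᵇ-⁅⁆ : (x v : Fin n) → v ∈ᵇ ⁅ x ⁆ ≡ does (x ≟ v)
∈ᵇ-⁅⁆ x v = does-⇔ (mk⇔ (sym ∘ x∈⁅y⁆⇒x≡y x) λ { refl → x∈⁅x⁆ x }) (v ∈? ⁅ x ⁆) (x ≟ v)

∈-imageS : (σ : Permutation′ n) {v : Fin n} {B : Subset n} → v ∈ imageS σ B ⇔ σ ⟨$⟩ˡ v ∈ B
∈-imageS σ {v} {B} = mk⇔
  (λ v∈σB → lookup⇒[]= _ B (trans (sym (lookup∘tabulate _ v)) ([]=⇒lookup v∈σB)))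
  (λ σv∈B → lookup⇒[]= v _ (trans (lookup∘tabulate _ v) ([]=⇒lookup σv∈B)))

∈ᵇ-imageS : (σ : Permutation′ n) (v : Fin n) (B : Subset n) → v ∈ᵇ imageS σ B ≡ (σ ⟨$⟩ˡ v) ∈ᵇ B
∈ᵇ-imageS σ v B = does-⇔ (∈-imageS σ) (v ∈? imageS σ B) ((σ ⟨$⟩ˡ v) ∈? B)

Disjoint : Subset n → Subset n → Set
Disjoint A B = A ∩ B ≡ ⊥

dropEmpty : List (Subset n) → List (Subset n)
dropEmpty = filter (λ B → ¬? (B ≟S ⊥))

∉-disjoint-⋃ : {B : Subset n} {Bs : List (Subset n)} {v : Fin n} →
  All (Disjoint B) Bs → v ∈ ⋃ Bs → v ∉ B
∉-disjoint-⋃ [] v∈⊥ _ = ∉⊥ v∈⊥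
∉-disjoint-⋃ {B = B} {B' ∷ Bs} {v} (B#B' ∷ B#Bs) v∈⋃ v∈B with x∈p∪q⁻ B' (⋃ Bs) v∈⋃
... | inj₁ v∈B' = ∉⊥ (subst (v ∈_) B#B' (x∈p∩q⁺ (v∈B , v∈B')))
... | inj₂ v∈⋃Bs = ∉-disjoint-⋃ B#Bs v∈⋃Bs v∈B

∈ᵇ-⋃-++ : (C D : List (Subset n)) (v : Fin n) → v ∈ᵇ ⋃ (C ++ D) ≡ v ∈ᵇ ⋃ C ∨ v ∈ᵇ ⋃ D
∈ᵇ-⋃-++ [] D v = cong (_∨ v ∈ᵇ ⋃ D) (sym (∈ᵇ-⊥ v))
∈ᵇ-⋃-++ (B ∷ Bs) D v = begin
  v ∈ᵇ (B ∪ ⋃ (Bs ++ D))             ≡⟨ ∈ᵇ-∪ v B _ ⟩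
  v ∈ᵇ B ∨ v ∈ᵇ ⋃ (Bs ++ D)          ≡⟨ cong (v ∈ᵇ B ∨_) (∈ᵇ-⋃-++ Bs D v) ⟩
  v ∈ᵇ B ∨ v ∈ᵇ ⋃ Bs ∨ v ∈ᵇ ⋃ D      ≡⟨ ∨-assoc (v ∈ᵇ B) _ _ ⟨
  (v ∈ᵇ B ∨ v ∈ᵇ ⋃ Bs) ∨ v ∈ᵇ ⋃ D    ≡⟨ cong (_∨ v ∈ᵇ ⋃ D) (∈ᵇ-∪ v B (⋃ Bs)) ⟨
  v ∈ᵇ (B ∪ ⋃ Bs) ∨ v ∈ᵇ ⋃ D         ∎

∈ᵇ-⋃-∩ : (S : Subset n) (C : List (Subset n)) (v : Fin n) →
  v ∈ᵇ ⋃ (map (_∩ S) C) ≡ v ∈ᵇ ⋃ C ∧ v ∈ᵇ S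
∈ᵇ-⋃-∩ S [] v rewrite ∈ᵇ-⊥ v = refl
∈ᵇ-⋃-∩ S (B ∷ Bs) v
  rewrite ∈ᵇ-∪ v (B ∩ S) (⋃ (map (_∩ S) Bs)) | ∈ᵇ-∩ v B S | ∈ᵇ-⋃-∩ S Bs v | ∈ᵇ-∪ v B (⋃ Bs) =
  solve 3 (λ b r s → b :* s :+ r :* s := (b :+ r) :* s) refl (v ∈ᵇ B) (v ∈ᵇ ⋃ Bs) (v ∈ᵇ S)

∈ᵇ-⋃-dropEmpty : (C : List (Subset n)) (v : Fin n) → v ∈ᵇ ⋃ (dropEmpty C) ≡ v ∈ᵇ ⋃ C
∈ᵇ-⋃-dropEmpty [] v = refl
∈ᵇ-⋃-dropEmpty (B ∷ Bs) v with B ≟S ⊥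
... | yes refl rewrite ∈ᵇ-∪ v ⊥ (⋃ Bs) | ∈ᵇ-⊥ v = ∈ᵇ-⋃-dropEmpty Bs v
... | no _ rewrite ∈ᵇ-∪ v B (⋃ (dropEmpty Bs)) | ∈ᵇ-∪ v B (⋃ Bs) = cong (v ∈ᵇ B ∨_) (∈ᵇ-⋃-dropEmpty Bs v)

∈ᵇ-⋃-imageS : (σ : Permutation′ n) (C : List (Subset n)) (v : Fin n) →
  v ∈ᵇ ⋃ (map (imageS σ) C) ≡ (σ ⟨$⟩ˡ v) ∈ᵇ ⋃ C
∈ᵇ-⋃-imageS σ [] v = trans (∈ᵇ-⊥ v) (sym (∈ᵇ-⊥ (σ ⟨$⟩ˡ v)))
∈ᵇ-⋃-imageS σ (B ∷ Bs) v = begin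
  v ∈ᵇ (imageS σ B ∪ ⋃ (map (imageS σ) Bs))          ≡⟨ ∈ᵇ-∪ v _ _ ⟩
  v ∈ᵇ imageS σ B ∨ v ∈ᵇ ⋃ (map (imageS σ) Bs)       ≡⟨ cong₂ _∨_ (∈ᵇ-imageS σ v B) (∈ᵇ-⋃-imageS σ Bs v) ⟩
  (σ ⟨$⟩ˡ v) ∈ᵇ B ∨ (σ ⟨$⟩ˡ v) ∈ᵇ ⋃ Bs               ≡⟨ ∈ᵇ-∪ (σ ⟨$⟩ˡ v) B (⋃ Bs) ⟨
  (σ ⟨$⟩ˡ v) ∈ᵇ (B ∪ ⋃ Bs)                           ∎

-- The block order of a composition

blockBefore⇒∈⋃ : (C : List (Subset n)) (u v : Fin n) → blockBefore C u v ≡ true → u ∈ ⋃ C × v ∈ ⋃ C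
blockBefore⇒∈⋃ (B ∷ Bs) u v h with ∨≡true⇒⊎ {u ∈ᵇ B ∧ v ∈ᵇ ⋃ Bs} h
... | inj₁ e = Product.map (p⊆p∪q (⋃ Bs)) (q⊆p∪q B _) (∈ᵇ-∧⁻ u v B (⋃ Bs) e)
... | inj₂ e = Product.map (q⊆p∪q B _) (q⊆p∪q B _) (blockBefore⇒∈⋃ Bs u v e)

blockBefore-total : (G : Graph n) (C : List (Subset n)) → All (Stable G) C →
  ∀ u v → u ∈ ⋃ C → v ∈ ⋃ C → Edge G u v → blockBefore C u v ≡ true ⊎ blockBefore C v u ≡ true
blockBefore-total G [] [] u v u∈⊥ _ _ = contradiction u∈⊥ ∉⊥
blockBefore-total G (B ∷ Bs) (stableB ∷ stableBs) u v u∈ v∈ uv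
  with x∈p∪q⁻ B (⋃ Bs) u∈ | x∈p∪q⁻ B (⋃ Bs) v∈
... | inj₁ u∈B | inj₁ v∈B = contradiction (trans (sym uv) (stableB u v u∈B v∈B)) λ ()
... | inj₁ u∈B | inj₂ v∈Bs rewrite ∈⇒∈ᵇ u∈B | ∈⇒∈ᵇ v∈Bs = inj₁ refl
... | inj₂ u∈Bs | inj₁ v∈B rewrite ∈⇒∈ᵇ v∈B | ∈⇒∈ᵇ u∈Bs = inj₂ refl
... | inj₂ u∈Bs | inj₂ v∈Bs =
  Sum.map (λ e → trans (cong (u ∈ᵇ B ∧ v ∈ᵇ ⋃ Bs ∨_) e) (∨-zeroʳ _))
          (λ e → trans (cong (v ∈ᵇ B ∧ u ∈ᵇ ⋃ Bs ∨_) e) (∨-zeroʳ _))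
          (blockBefore-total G Bs stableBs u v u∈Bs v∈Bs uv)

blockIndex : List (Subset n) → Fin n → ℕ
blockIndex [] u = zero
blockIndex (B ∷ Bs) u = if u ∈ᵇ B then zero else suc (blockIndex Bs u)

blockIndex-∈ : {B : Subset n} {Bs : List (Subset n)} {u : Fin n} → u ∈ B → blockIndex (B ∷ Bs) u ≡ zero
blockIndex-∈ u∈B rewrite ∈⇒∈ᵇ u∈B = refl

blockIndex-∉ : {B : Subset n} {Bs : List (Subset n)} {u : Fin n} →
  u ∉ B → blockIndex (B ∷ Bs) u ≡ suc (blockIndex Bs u)
blockIndex-∉ u∉B rewrite ∉⇒∈ᵇ u∉B = refl

blockBefore⇒blockIndex< : (C : List (Subset n)) → AllPairs Disjoint C →
  ∀ u v → blockBefore C u v ≡ true → blockIndex C u < blockIndex C v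
blockBefore⇒blockIndex< (B ∷ Bs) (B#Bs ∷ disjoint) u v h with ∨≡true⇒⊎ {u ∈ᵇ B ∧ v ∈ᵇ ⋃ Bs} h
... | inj₁ e = let u∈B , v∈Bs = ∈ᵇ-∧⁻ u v B (⋃ Bs) e in
  subst₂ _<_ (sym (blockIndex-∈ {Bs = Bs} u∈B)) (sym (blockIndex-∉ {Bs = Bs} (∉-disjoint-⋃ B#Bs v∈Bs))) z<s
... | inj₂ e = let u∈Bs , v∈Bs = blockBefore⇒∈⋃ Bs u v e in
  subst₂ _<_ (sym (blockIndex-∉ {Bs = Bs} (∉-disjoint-⋃ B#Bs u∈Bs)))
             (sym (blockIndex-∉ {Bs = Bs} (∉-disjoint-⋃ B#Bs v∈Bs)))
    (s<s (blockBefore⇒blockIndex< Bs disjoint u v e))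

blockBefore-++ : (C D : List (Subset n)) (u v : Fin n) →
  blockBefore (C ++ D) u v ≡ blockBefore C u v ∨ blockBefore D u v ∨ (u ∈ᵇ ⋃ C ∧ v ∈ᵇ ⋃ D)
blockBefore-++ [] D u v rewrite ∈ᵇ-⊥ u = sym (∨-identityʳ _)
blockBefore-++ (B ∷ Bs) D u v
  rewrite ∈ᵇ-⋃-++ Bs D v | blockBefore-++ Bs D u v | ∈ᵇ-∪ u B (⋃ Bs) =
  solve 6 (λ b c d p q r → b :* (c :+ d) :+ (p :+ (q :+ r :* d)) := (b :* c :+ p) :+ (q :+ (b :+ r) :* d)) refl
    (u ∈ᵇ B) (v ∈ᵇ ⋃ Bs) (v ∈ᵇ ⋃ D) (blockBefore Bs u v) (blockBefore D u v) (u ∈ᵇ ⋃ Bs)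

blockBefore-∩ : (S : Subset n) (C : List (Subset n)) (u v : Fin n) →
  blockBefore (map (_∩ S) C) u v ≡ blockBefore C u v ∧ u ∈ᵇ S ∧ v ∈ᵇ S
blockBefore-∩ S [] u v = refl
blockBefore-∩ S (B ∷ Bs) u v rewrite ∈ᵇ-∩ u B S | ∈ᵇ-⋃-∩ S Bs v | blockBefore-∩ S Bs u v =
  solve 5 (λ b s c t p → b :* s :* (c :* t) :+ p :* (s :* t) := (b :* c :+ p) :* (s :* t)) refl
    (u ∈ᵇ B) (u ∈ᵇ S) (v ∈ᵇ ⋃ Bs) (v ∈ᵇ S) (blockBefore Bs u v)

blockBefore-dropEmpty : (C : List (Subset n)) (u v : Fin n) → blockBefore (dropEmpty C) u v ≡ blockBefore C u v
blockBefore-dropEmpty [] u v = refl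
blockBefore-dropEmpty (B ∷ Bs) u v with B ≟S ⊥
... | yes refl rewrite ∈ᵇ-⊥ u = blockBefore-dropEmpty Bs u v
... | no _ rewrite ∈ᵇ-⋃-dropEmpty Bs v | blockBefore-dropEmpty Bs u v = refl

blockBefore-restrict : (S : Subset n) (C : List (Subset n)) (u v : Fin n) →
  blockBefore (restrictComp S C) u v ≡ blockBefore C u v ∧ u ∈ᵇ S ∧ v ∈ᵇ S
blockBefore-restrict S C u v = trans (blockBefore-dropEmpty (map (_∩ S) C) u v) (blockBefore-∩ S C u v)

blockBefore-imageS : (σ : Permutation′ n) (C : List (Subset n)) (u v : Fin n) →
  blockBefore (map (imageS σ) C) u v ≡ blockBefore C (σ ⟨$⟩ˡ u) (σ ⟨$⟩ˡ v)
blockBefore-imageS σ [] u v = refl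
blockBefore-imageS σ (B ∷ Bs) u v =
  cong₂ _∨_ (cong₂ _∧_ (∈ᵇ-imageS σ u B) (∈ᵇ-⋃-imageS σ Bs v)) (blockBefore-imageS σ Bs u v)

-- The partition into blocks of a composition

sameBlock⇒∈⋃ : (C : List (Subset n)) (u v : Fin n) → sameBlock C u v ≡ true → u ∈ ⋃ C × v ∈ ⋃ C
sameBlock⇒∈⋃ (B ∷ Bs) u v h with ∨≡true⇒⊎ {u ∈ᵇ B ∧ v ∈ᵇ B} h
... | inj₁ e = Product.map (p⊆p∪q (⋃ Bs)) (p⊆p∪q (⋃ Bs)) (∈ᵇ-∧⁻ u v B B e)
... | inj₂ e = Product.map (q⊆p∪q B _) (q⊆p∪q B _) (sameBlock⇒∈⋃ Bs u v e)

sameBlock-refl : (C : List (Subset n)) (u : Fin n) → u ∈ ⋃ C → sameBlock C u u ≡ true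
sameBlock-refl [] u u∈⊥ = contradiction u∈⊥ ∉⊥
sameBlock-refl (B ∷ Bs) u u∈ with x∈p∪q⁻ B (⋃ Bs) u∈
... | inj₁ u∈B rewrite ∈⇒∈ᵇ u∈B = refl
... | inj₂ u∈Bs = trans (cong (u ∈ᵇ B ∧ u ∈ᵇ B ∨_) (sameBlock-refl Bs u u∈Bs)) (∨-zeroʳ _)

sameBlock-sym : (C : List (Subset n)) (u v : Fin n) → sameBlock C u v ≡ sameBlock C v u
sameBlock-sym [] u v = refl
sameBlock-sym (B ∷ Bs) u v = cong₂ _∨_ (∧-comm (u ∈ᵇ B) (v ∈ᵇ B)) (sameBlock-sym Bs u v)

sameBlock-trans : (C : List (Subset n)) → AllPairs Disjoint C → ∀ u v w →
  sameBlock C u v ≡ true → sameBlock C v w ≡ true → sameBlock C u w ≡ true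
sameBlock-trans (B ∷ Bs) (B#Bs ∷ disjoint) u v w uv vw
  with ∨≡true⇒⊎ {u ∈ᵇ B ∧ v ∈ᵇ B} uv | ∨≡true⇒⊎ {v ∈ᵇ B ∧ w ∈ᵇ B} vw
... | inj₁ uvB | inj₁ vwB =
  cong (_∨ sameBlock Bs u w) (cong₂ _∧_ (∈⇒∈ᵇ (proj₁ (∈ᵇ-∧⁻ u v B B uvB))) (∈⇒∈ᵇ (proj₂ (∈ᵇ-∧⁻ v w B B vwB))))
... | inj₁ uvB | inj₂ vwBs =
  contradiction (proj₂ (∈ᵇ-∧⁻ u v B B uvB)) (∉-disjoint-⋃ B#Bs (proj₁ (sameBlock⇒∈⋃ Bs v w vwBs)))
... | inj₂ uvBs | inj₁ vwB =
  contradiction (proj₁ (∈ᵇ-∧⁻ v w B B vwB)) (∉-disjoint-⋃ B#Bs (proj₂ (sameBlock⇒∈⋃ Bs u v uvBs)))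
... | inj₂ uvBs | inj₂ vwBs =
  trans (cong (u ∈ᵇ B ∧ w ∈ᵇ B ∨_) (sameBlock-trans Bs disjoint u v w uvBs vwBs)) (∨-zeroʳ _)

sameBlock-stable : (G : Graph n) (C : List (Subset n)) → All (Stable G) C →
  ∀ u v → sameBlock C u v ≡ true → adj G u v ≡ false
sameBlock-stable G (B ∷ Bs) (stableB ∷ stableBs) u v h with ∨≡true⇒⊎ {u ∈ᵇ B ∧ v ∈ᵇ B} h
... | inj₁ e = let u∈B , v∈B = ∈ᵇ-∧⁻ u v B B e in stableB u v u∈B v∈B
... | inj₂ e = sameBlock-stable G Bs stableBs u v e

sameBlock-++ : (C D : List (Subset n)) (u v : Fin n) →
  sameBlock (C ++ D) u v ≡ sameBlock C u v ∨ sameBlock D u v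
sameBlock-++ [] D u v = refl
sameBlock-++ (B ∷ Bs) D u v =
  trans (cong (u ∈ᵇ B ∧ v ∈ᵇ B ∨_) (sameBlock-++ Bs D u v)) (sym (∨-assoc (u ∈ᵇ B ∧ v ∈ᵇ B) _ _))

sameBlock-∩ : (S : Subset n) (C : List (Subset n)) (u v : Fin n) →
  sameBlock (map (_∩ S) C) u v ≡ sameBlock C u v ∧ u ∈ᵇ S ∧ v ∈ᵇ S
sameBlock-∩ S [] u v = refl
sameBlock-∩ S (B ∷ Bs) u v rewrite ∈ᵇ-∩ u B S | ∈ᵇ-∩ v B S | sameBlock-∩ S Bs u v =
  solve 5 (λ b s c t p → b :* s :* (c :* t) :+ p :* (s :* t) := (b :* c :+ p) :* (s :* t)) refl
    (u ∈ᵇ B) (u ∈ᵇ S) (v ∈ᵇ B) (v ∈ᵇ S) (sameBlock Bs u v)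

sameBlock-dropEmpty : (C : List (Subset n)) (u v : Fin n) → sameBlock (dropEmpty C) u v ≡ sameBlock C u v
sameBlock-dropEmpty [] u v = refl
sameBlock-dropEmpty (B ∷ Bs) u v with B ≟S ⊥
... | yes refl rewrite ∈ᵇ-⊥ u = sameBlock-dropEmpty Bs u v
... | no _ = cong (u ∈ᵇ B ∧ v ∈ᵇ B ∨_) (sameBlock-dropEmpty Bs u v)

sameBlock-restrict : (S : Subset n) (C : List (Subset n)) (u v : Fin n) →
  sameBlock (restrictComp S C) u v ≡ sameBlock C u v ∧ u ∈ᵇ S ∧ v ∈ᵇ S
sameBlock-restrict S C u v = trans (sameBlock-dropEmpty (map (_∩ S) C) u v) (sameBlock-∩ S C u v)

sameBlock-imageS : (σ : Permutation′ n) (C : List (Subset n)) (u v : Fin n) →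
  sameBlock (map (imageS σ) C) u v ≡ sameBlock C (σ ⟨$⟩ˡ u) (σ ⟨$⟩ˡ v)
sameBlock-imageS σ [] u v = refl
sameBlock-imageS σ (B ∷ Bs) u v =
  cong₂ _∨_ (cong₂ _∧_ (∈ᵇ-imageS σ u B) (∈ᵇ-imageS σ v B)) (sameBlock-imageS σ Bs u v)

⁅⁆-disjoint : {x y : Fin n} → x ≢ y → Disjoint ⁅ x ⁆ ⁅ y ⁆
⁅⁆-disjoint {x = x} {y} x≢y = Empty-unique λ (z , z∈x∩y) →
  let z∈x , z∈y = x∈p∩q⁻ ⁅ x ⁆ ⁅ y ⁆ z∈x∩y in
  x≢y (trans (sym (x∈⁅y⁆⇒x≡y x z∈x)) (x∈⁅y⁆⇒x≡y y z∈y))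

⁅⁆-∩-∈ : {x : Fin n} {S : Subset n} → x ∈ S → ⁅ x ⁆ ∩ S ≡ ⁅ x ⁆
⁅⁆-∩-∈ {x = x} {S} x∈S = ⊆-antisym (p∩q⊆p ⁅ x ⁆ S)
  λ z∈x → x∈p∩q⁺ (z∈x , subst (_∈ S) (sym (x∈⁅y⁆⇒x≡y x z∈x)) x∈S)

⁅⁆-∩-∉ : {x : Fin n} {S : Subset n} → x ∉ S → ⁅ x ⁆ ∩ S ≡ ⊥
⁅⁆-∩-∉ {x = x} {S} x∉S = Empty-unique λ (z , z∈x∩S) →
  let z∈x , z∈S = x∈p∩q⁻ ⁅ x ⁆ S z∈x∩S in
  x∉S (subst (_∈ S) (x∈⁅y⁆⇒x≡y x z∈x) z∈S)

⁅⁆≢⊥ : (x : Fin n) → ⁅ x ⁆ ≢ ⊥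
⁅⁆≢⊥ x e = ∉⊥ (subst (x ∈_) e (x∈⁅x⁆ x))

⁅⁆-stable : (G : Graph n) (x : Fin n) → Stable G ⁅ x ⁆
⁅⁆-stable G x u v u∈x v∈x = trans (cong₂ (adj G) (x∈⁅y⁆⇒x≡y x u∈x) (x∈⁅y⁆⇒x≡y x v∈x)) (adj-irr G x)

imageS-⁅⁆ : (σ : Permutation′ n) (x : Fin n) → imageS σ ⁅ x ⁆ ≡ ⁅ σ ⟨$⟩ʳ x ⁆
imageS-⁅⁆ σ x = ⊆-antisym into outof
  where
  into : imageS σ ⁅ x ⁆ ⊆ ⁅ σ ⟨$⟩ʳ x ⁆
  into {v} v∈σx rewrite sym (x∈⁅y⁆⇒x≡y x (Equivalence.to (∈-imageS σ) v∈σx)) | inverseʳ σ {v} = x∈⁅x⁆ v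
  outof : ⁅ σ ⟨$⟩ʳ x ⁆ ⊆ imageS σ ⁅ x ⁆
  outof v∈ with refl ← x∈⁅y⁆⇒x≡y (σ ⟨$⟩ʳ x) v∈ =
    Equivalence.from (∈-imageS σ) (subst (_∈ ⁅ x ⁆) (sym (inverseˡ σ)) (x∈⁅x⁆ x))

any-≟ : (ℓ : List (Fin n)) (v : Fin n) → any (λ y → does (y ≟ v)) ℓ ≡ does (any? (v ≟_) ℓ)
any-≟ [] v = refl
any-≟ (x ∷ xs) v = cong₂ _∨_ (does-⇔ (mk⇔ sym sym) (x ≟ v) (v ≟ x)) (any-≟ xs v)

∈ᵇ-⋃-singletons : (ℓ : List (Fin n)) (v : Fin n) → v ∈ᵇ ⋃ (map ⁅_⁆ ℓ) ≡ any (λ y → does (y ≟ v)) ℓ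
∈ᵇ-⋃-singletons [] v = ∈ᵇ-⊥ v
∈ᵇ-⋃-singletons (x ∷ xs) v = trans (∈ᵇ-∪ v ⁅ x ⁆ _) (cong₂ _∨_ (∈ᵇ-⁅⁆ x v) (∈ᵇ-⋃-singletons xs v))

blockBefore-singletons : (ℓ : List (Fin n)) (u v : Fin n) → blockBefore (map ⁅_⁆ ℓ) u v ≡ before ℓ u v
blockBefore-singletons [] u v = refl
blockBefore-singletons (x ∷ xs) u v =
  cong₂ _∨_ (cong₂ _∧_ (∈ᵇ-⁅⁆ x u) (∈ᵇ-⋃-singletons xs v)) (blockBefore-singletons xs u v)

singletons-filter : (S : Subset n) (ℓ : List (Fin n)) → map ⁅_⁆ (filter (_∈? S) ℓ) ≡ restrictComp S (map ⁅_⁆ ℓ)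
singletons-filter S [] = refl
singletons-filter S (x ∷ xs) with x ∈? S
... | yes x∈S = begin
  ⁅ x ⁆ ∷ map ⁅_⁆ (filter (_∈? S) xs)
    ≡⟨ cong₂ _∷_ (sym (⁅⁆-∩-∈ x∈S)) (singletons-filter S xs) ⟩
  (⁅ x ⁆ ∩ S) ∷ restrictComp S (map ⁅_⁆ xs)
    ≡⟨ filter-accept (λ B → ¬? (B ≟S ⊥)) (λ x∩S≡⊥ → ⁅⁆≢⊥ x (trans (sym (⁅⁆-∩-∈ x∈S)) x∩S≡⊥)) ⟨
  dropEmpty ((⁅ x ⁆ ∩ S) ∷ map (_∩ S) (map ⁅_⁆ xs)) ∎
... | no x∉S = trans (singletons-filter S xs)
  (sym (filter-reject (λ B → ¬? (B ≟S ⊥)) (λ x∩S≢⊥ → x∩S≢⊥ (⁅⁆-∩-∉ x∉S))))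

-- Orientations with a strictly increasing rank

module _ (o : Fin n → Fin n → Bool) (rank : Fin n → ℕ)
         (increasing : ∀ u v → o u v ≡ true → rank u < rank v) where

  ranked-antisymmetric : ∀ u v → o u v ≡ true → o v u ≡ false
  ranked-antisymmetric u v uv with o v u in vu
  ... | false = refl
  ... | true = contradiction (increasing v u vu) (<-asym (increasing u v uv))

  ranked-path : ∀ {u v} → TransClosure (λ a b → o a b ≡ true) u v → rank u < rank v
  ranked-path [ uv ] = increasing _ _ uv
  ranked-path (uw ∷ wv) = <-trans (increasing _ _ uw) (ranked-path wv)

  ranked-acyclic : ∀ u → ¬ TransClosure (λ a b → o a b ≡ true) u u
  ranked-acyclic u cycle = <-irrefl refl (ranked-path cycle)

IsAcyclicOrientation-resp : {G : Graph n} {U : Subset n} {o o' : Fin n → Fin n → Bool} →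
  (∀ u v → o u v ≡ o' u v) → IsAcyclicOrientation G U o → IsAcyclicOrientation G U o'
IsAcyclicOrientation-resp o≗o' (support , total , antisym , acyclic) =
  (λ u v e → support u v (trans (o≗o' u v) e)) ,
  (λ u v u∈ v∈ uv → Sum.map (trans (sym (o≗o' u v))) (trans (sym (o≗o' v u))) (total u v u∈ v∈ uv)) ,
  (λ u v e → trans (sym (o≗o' v u)) (antisym u v (trans (o≗o' u v) e))) ,
  (λ u cycle → acyclic u (Equivalence.to Transitive.equivalent
    (Transitive.map {f = id} (trans (o≗o' _ _)) (Equivalence.from Transitive.equivalent cycle))))

∘-isHopfMorphism : {h k m : BasisHopfSpecies}
  {f : ∀ {n} → Graph n → Raw h n → Raw k n} {g : ∀ {n} → Graph n → Raw k n → Raw m n} →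
  (∀ {n} {x y : Raw k n} → _≈_ k x y → x ≡ y) →
  IsHopfMorphism h k f → IsHopfMorphism k m g → IsHopfMorphism h m (λ G → g G ∘ f G)
∘-isHopfMorphism {h} {k} {m} {f} {g} ≈⇒≡ F H = record
  { well-defined = λ G U x x-valid → H.well-defined G U _ (F.well-defined G U x x-valid)
  ; natural = λ σ G G' iso U x x-valid →
      subst (λ y → _≈_ m (g G' y) (relabel m σ (g G (f G x)))) (sym (≈⇒≡ (F.natural σ G G' iso U x x-valid)))
        (H.natural σ G G' iso U _ (F.well-defined G U x x-valid))
  ; pres-mul = λ G U S T U=S∪T x y x-valid y-valid →
      subst (λ z → _≈_ m (g G z) (mul m G S T (g G (f G x)) (g G (f G y))))
        (sym (≈⇒≡ (F.pres-mul G U S T U=S∪T x y x-valid y-valid)))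
        (H.pres-mul G U S T U=S∪T _ _ (F.well-defined G S x x-valid) (F.well-defined G T y y-valid))
  ; pres-comul = λ G U S T U=S∪T x x-valid →
      let fS , fT = F.pres-comul G U S T U=S∪T x x-valid
          gS , gT = H.pres-comul G U S T U=S∪T _ (F.well-defined G U x x-valid)
          pull : ∀ P {z} → res k P (f G x) ≡ z → _≈_ m (g G (res k P (f G x))) (res m P (g G (f G x))) →
                 _≈_ m (g G z) (res m P (g G (f G x)))
          pull P eq = subst (λ z → _≈_ m (g G z) (res m P (g G (f G x)))) eq
      in pull S (sym (≈⇒≡ fS)) gS , pull T (sym (≈⇒≡ fT)) gT
  ; pres-unit = λ G → subst (λ z → _≈_ m (g G z) (unit m)) (sym (≈⇒≡ (F.pres-unit G))) (H.pres-unit G)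
  }
  where
  module F = IsHopfMorphism F
  module H = IsHopfMorphism H

isHopfMorphism-𝐀⃗-resp : {h : BasisHopfSpecies} {f g : ∀ {n} → Graph n → Raw h n → Raw 𝐀⃗ n} →
  (∀ {n} (G : Graph n) x u v → f G x u v ≡ g G x u v) →
  IsHopfMorphism h 𝐀⃗ f → IsHopfMorphism h 𝐀⃗ g
isHopfMorphism-𝐀⃗-resp f≗g F = record
  { well-defined = λ G U x x-valid → IsAcyclicOrientation-resp {G = G} (f≗g G x) (F.well-defined G U x x-valid)
  ; natural = λ σ G G' iso U x x-valid u v →
      trans (sym (f≗g G' _ u v)) (trans (F.natural σ G G' iso U x x-valid u v) (f≗g G x _ _))
  ; pres-mul = λ G U S T U=S∪T x y x-valid y-valid u v →
      trans (sym (f≗g G _ u v)) (trans (F.pres-mul G U S T U=S∪T x y x-valid y-valid u v)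
        (cong₂ (λ a b → a ∨ b ∨ (u ∈ᵇ S ∧ v ∈ᵇ T ∧ adj G u v)) (f≗g G x u v) (f≗g G y u v)))
  ; pres-comul = λ G U S T U=S∪T x x-valid →
      let fS , fT = F.pres-comul G U S T U=S∪T x x-valid
      in (λ u v → trans (sym (f≗g G _ u v)) (trans (fS u v) (cong (_∧ u ∈ᵇ S ∧ v ∈ᵇ S) (f≗g G x u v)))) ,
         (λ u v → trans (sym (f≗g G _ u v)) (trans (fT u v) (cong (_∧ u ∈ᵇ T ∧ v ∈ᵇ T) (f≗g G x u v))))
  ; pres-unit = λ G u v → trans (sym (f≗g G _ u v)) (F.pres-unit G u v)
  }
  where
  module F = IsHopfMorphism F

-- Every component of 𝐄 is the unit type, so all the required equations hold by η.
isHopfMorphism-𝐄 : {h : BasisHopfSpecies} (f : ∀ {n} → Graph n → Raw h n → Raw 𝐄 n) → IsHopfMorphism h 𝐄 f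
isHopfMorphism-𝐄 f = record
  { well-defined = λ _ _ _ _ → tt
  ; natural = λ _ _ _ _ _ _ _ → refl
  ; pres-mul = λ _ _ _ _ _ _ _ _ _ → refl
  ; pres-comul = λ _ _ _ _ _ _ _ → refl , refl
  ; pres-unit = λ _ → refl
  }

adj-relabel : (σ : Permutation′ n) (G G' : Graph n) → IsGraphIso σ G G' →
  ∀ u v → adj G' u v ≡ adj G (σ ⟨$⟩ˡ u) (σ ⟨$⟩ˡ v)
adj-relabel σ G G' iso u v = trans (sym (cong₂ (adj G') (inverseʳ σ) (inverseʳ σ))) (iso (σ ⟨$⟩ˡ u) (σ ⟨$⟩ˡ v))

ι-isHopfMorphism : IsHopfMorphism 𝐋 𝐒𝚺 ι
ι-isHopfMorphism = record
  { well-defined = λ G U ℓ → isStableComp G U ℓ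
  ; natural = λ σ G G' iso U ℓ _ →
      trans (sym (map-∘ ℓ)) (trans (map-cong (sym ∘ imageS-⁅⁆ σ) ℓ) (map-∘ ℓ))
  ; pres-mul = λ G U S T _ ℓ ℓ' _ _ → map-++ ⁅_⁆ ℓ ℓ'
  ; pres-comul = λ G U S T _ ℓ _ → singletons-filter S ℓ , singletons-filter T ℓ
  ; pres-unit = λ G → refl
  }
  where
  isStableComp : (G : Graph n) (U : Subset n) (ℓ : List (Fin n)) → IsLinOrd G U ℓ → IsStableComp G U (map ⁅_⁆ ℓ)
  isStableComp G U ℓ (unique , ℓ≈U) =
    All.map⁺ (All.universal (λ x → x , x∈⁅x⁆ x) ℓ) ,
    AllPairs.map⁺ (AllPairs.map ⁅⁆-disjoint unique) ,
    ∈ᵇ-ext (λ v → trans (∈ᵇ-⋃-singletons ℓ v) (trans (any-≟ ℓ v) (does-⇔ (ℓ≈U v) (any? (v ≟_) ℓ) (v ∈? U)))) ,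
    All.map⁺ (All.universal (⁅⁆-stable G) ℓ)

π⃗ˢ-isHopfMorphism : IsHopfMorphism 𝐒𝚺 𝐀⃗ π⃗ˢ
π⃗ˢ-isHopfMorphism = record
  { well-defined = isAcyclicOrientation
  ; natural = λ σ G G' iso U C _ u v →
      cong₂ _∧_ (adj-relabel σ G G' iso u v) (blockBefore-imageS σ C u v)
  ; pres-mul = λ G U S T _ C D (_ , _ , ⋃C≡S , _) (_ , _ , ⋃D≡T , _) → concat G C D ⋃C≡S ⋃D≡T
  ; pres-comul = λ G U S T _ C _ → restrict G S C , restrict G T C
  ; pres-unit = λ G u v → ∧-zeroʳ (adj G u v)
  }
  where
  concat : (G : Graph n) (C D : List (Subset n)) {S T : Subset n} → ⋃ C ≡ S → ⋃ D ≡ T → ∀ u v →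
    π⃗ˢ G (C ++ D) u v ≡ π⃗ˢ G C u v ∨ π⃗ˢ G D u v ∨ (u ∈ᵇ S ∧ v ∈ᵇ T ∧ adj G u v)
  concat G C D refl refl u v = begin
    adj G u v ∧ blockBefore (C ++ D) u v
      ≡⟨ cong (adj G u v ∧_) (blockBefore-++ C D u v) ⟩
    adj G u v ∧ (blockBefore C u v ∨ blockBefore D u v ∨ (u ∈ᵇ ⋃ C ∧ v ∈ᵇ ⋃ D))
      ≡⟨ solve 5 (λ a b c s t → a :* (b :+ (c :+ s :* t)) := a :* b :+ (a :* c :+ s :* (t :* a))) refl
           (adj G u v) (blockBefore C u v) (blockBefore D u v) (u ∈ᵇ ⋃ C) (v ∈ᵇ ⋃ D) ⟩
    π⃗ˢ G C u v ∨ π⃗ˢ G D u v ∨ (u ∈ᵇ ⋃ C ∧ v ∈ᵇ ⋃ D ∧ adj G u v) ∎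

  restrict : (G : Graph n) (S : Subset n) (C : List (Subset n)) (u v : Fin n) →
    π⃗ˢ G (restrictComp S C) u v ≡ π⃗ˢ G C u v ∧ u ∈ᵇ S ∧ v ∈ᵇ S
  restrict G S C u v =
    trans (cong (adj G u v ∧_) (blockBefore-restrict S C u v)) (sym (∧-assoc (adj G u v) _ _))

  isAcyclicOrientation : (G : Graph n) (U : Subset n) (C : List (Subset n)) →
    IsStableComp G U C → IsAcyclicOrientation G U (π⃗ˢ G C)
  isAcyclicOrientation G U C (_ , disjoint , ⋃C≡U , stable) =
    support , total ,
    ranked-antisymmetric (π⃗ˢ G C) (blockIndex C) increasing ,
    ranked-acyclic (π⃗ˢ G C) (blockIndex C) increasing
    where
    support : ∀ u v → π⃗ˢ G C u v ≡ true → u ∈ U × v ∈ U × Edge G u v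
    support u v e =
      let uv , before = ∧≡true⇒× {adj G u v} e
          u∈ , v∈ = blockBefore⇒∈⋃ C u v before
      in subst (u ∈_) ⋃C≡U u∈ , subst (v ∈_) ⋃C≡U v∈ , uv
    total : ∀ u v → u ∈ U → v ∈ U → Edge G u v → π⃗ˢ G C u v ≡ true ⊎ π⃗ˢ G C v u ≡ true
    total u v u∈ v∈ uv =
      Sum.map (λ e → cong₂ _∧_ uv e) (λ e → cong₂ _∧_ (trans (adj-sym G v u) uv) e)
        (blockBefore-total G C stable u v (subst (u ∈_) (sym ⋃C≡U) u∈) (subst (v ∈_) (sym ⋃C≡U) v∈) uv)
    increasing : ∀ u v → π⃗ˢ G C u v ≡ true → blockIndex C u < blockIndex C v
    increasing u v e = blockBefore⇒blockIndex< C disjoint u v (proj₂ (∧≡true⇒× {adj G u v} e))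

π⃗ˢ∘ι≡π⃗ᴸ : (G : Graph n) (ℓ : List (Fin n)) (u v : Fin n) → π⃗ˢ G (ι G ℓ) u v ≡ π⃗ᴸ G ℓ u v
π⃗ˢ∘ι≡π⃗ᴸ G ℓ u v = cong (adj G u v ∧_) (blockBefore-singletons ℓ u v)

π⃗ᴸ-isHopfMorphism : IsHopfMorphism 𝐋 𝐀⃗ π⃗ᴸ
π⃗ᴸ-isHopfMorphism = isHopfMorphism-𝐀⃗-resp π⃗ˢ∘ι≡π⃗ᴸ (∘-isHopfMorphism id ι-isHopfMorphism π⃗ˢ-isHopfMorphism)

πˢ-isHopfMorphism : IsHopfMorphism 𝐒𝚺 𝐒𝚷 πˢ
πˢ-isHopfMorphism = record
  { well-defined = λ G U C → isStablePartition G U C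
  ; natural = λ σ G G' iso U C _ → sameBlock-imageS σ C
  ; pres-mul = λ G U S T _ C D _ _ → sameBlock-++ C D
  ; pres-comul = λ G U S T _ C _ → sameBlock-restrict S C , sameBlock-restrict T C
  ; pres-unit = λ G u v → refl
  }
  where
  isStablePartition : (G : Graph n) (U : Subset n) (C : List (Subset n)) →
    IsStableComp G U C → IsStablePartition G U (πˢ G C)
  isStablePartition G U C (_ , disjoint , ⋃C≡U , stable) =
    (λ u v e → Product.map (subst (u ∈_) ⋃C≡U) (subst (v ∈_) ⋃C≡U) (sameBlock⇒∈⋃ C u v e)) ,
    (λ u u∈ → sameBlock-refl C u (subst (u ∈_) (sym ⋃C≡U) u∈)) ,
    (λ u v e → trans (sameBlock-sym C v u) e) ,
    sameBlock-trans C disjoint ,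
    sameBlock-stable G C stable

mainTheorem15 :
    IsHopfMorphism 𝐋 𝐒𝚺 ι ×
    IsHopfMorphism 𝐋 𝐀⃗ π⃗ᴸ ×
    IsHopfMorphism 𝐒𝚺 𝐀⃗ π⃗ˢ ×
    IsHopfMorphism 𝐒𝚺 𝐒𝚷 πˢ ×
    IsHopfMorphism 𝐒𝚷 𝐄 ρ ×
    IsHopfMorphism 𝐀⃗ 𝐄 πᴬ ×
    (∀ {n} (G : Graph n) (U : Subset n) (ℓ : List (Fin n)) → IsLinOrd G U ℓ →
       ∀ u v → π⃗ˢ G (ι G ℓ) u v ≡ π⃗ᴸ G ℓ u v) ×
    (∀ {n} (G : Graph n) (U : Subset n) (C : List (Subset n)) → IsStableComp G U C →
       πᴬ G (π⃗ˢ G C) ≡ ρ G (πˢ G C)) ×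
    (∀ {n} (G : Graph n) (U : Subset n) (ℓ : List (Fin n)) → IsLinOrd G U ℓ →
       (πᴬ G (π⃗ᴸ G ℓ) ≡ tt) × (ρ G (πˢ G (ι G ℓ)) ≡ tt))
mainTheorem15 =
  ι-isHopfMorphism , π⃗ᴸ-isHopfMorphism , π⃗ˢ-isHopfMorphism , πˢ-isHopfMorphism ,
  isHopfMorphism-𝐄 ρ , isHopfMorphism-𝐄 πᴬ ,
  (λ G _ ℓ _ → π⃗ˢ∘ι≡π⃗ᴸ G ℓ) ,
  (λ _ _ _ _ → refl) ,
  (λ _ _ _ _ → refl , refl)
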